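{- Let $n,k$ be positive integers with $2\le k<n$, and let $G_{n,k}$ be the transition digraph for $\mathcal P(n,k)$. Then $G_{n,k}$ has an Eulerian cycle (a closed directed walk traversing each edge exactly once).
   Context: $[m]=\{1,\dots,m\}$; $\mathcal P(n,k)$ is the set of partitions of $[n]$ into exactly $k$ nonempty parts ($k$-partitions of $[n]$). For $m\ge 1$, a representation of a partition $p$ of $[m]$ with at most $k$ parts is a string $r_1\cdots r_m$ over the alphabet $[k]$ such that $r_i=r_j$ if and only if $i,j$ lie in the same part of $p$. The transition digraph $G_{n,k}$: its vertices are all $k$-partitions and all $(k-1)$-partitions of $[n-1]$. There is an edge from $v$ to $w$ if and only if there are a representation of $v$ and a representation of $w$ such that the last $n-2$ symbols of the former equal the first $n-2$ symbols of the latter and the length-$n$ string formed by overlaying the two at this common substring is a representation of a $k$-partition of $[n]$. Equivalently, the edges are the $k$-partitions $p$ of $[n]$: the edge $p$ goes from the partition of $[n-1]$ represented by the first $n-1$ symbols of a representation of $p$ to the partition of $[n-1]$ represented by the last $n-1$ symbols. Loops are allowed. -}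

module Defs where

open import Data.Empty using (⊥)
open import Data.Fin using (Fin; zero; suc; inject₁; fromℕ)
open import Data.Fin.Subset using (Subset; _∈_; Nonempty)
open import Data.Nat using (ℕ; suc; 2+; _∸_)
open import Data.Product using (_×_; _,_; ∃; ∃-syntax; ∃!)
open import Data.Sum using ([_,_])
open import Data.Sum.Relation.Binary.Pointwise using (⊎-setoid; inj₁; inj₂)
open import Data.Vec using (Vec; _∷_; lookup; head; tail; init)
open import Function using (_⇔_; mk⇔; Equivalence)
open import Level using (0ℓ)
open import Relation.Binary using (Rel; Setoid; _Respects₂_)
open import Relation.Binary.PropositionalEquality using (_≡_; refl; trans; subst)

record Digraph : Set₁ where
  field
    vertices : Setoid 0ℓ 0ℓ
  open Setoid vertices public using (_≈_) renaming (Carrier to Vertex)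
  field
    Edge : Rel Vertex 0ℓ
    resp : Edge Respects₂ _≈_

record EulerianCycle (G : Digraph) : Set where
  open Digraph G
  field
    length : ℕ
    walk   : Fin (suc length) → Vertex
    closed : walk zero ≈ walk (fromℕ length)
    step   : ∀ i → Edge (walk (inject₁ i)) (walk (suc i))
    once   : ∀ {v w} → Edge v w →
             ∃! _≡_ λ i → (walk (inject₁ i) ≈ v) × (walk (suc i) ≈ w)

-- The parts carry an arbitrary numbering, which the equality _≋_ below forgets.
record 𝒫 (n k : ℕ) : Set where
  field
    part     : Fin k → Subset n
    nonempty : ∀ a → Nonempty (part a)
    disjoint : ∀ {a b i} → i ∈ part a → i ∈ part b → a ≡ b
    cover    : ∀ i → ∃[ a ] i ∈ part a

open 𝒫

_⊑_ : ∀ {n k} → Rel (𝒫 n k) 0ℓ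
p ⊑ q = ∀ a → ∃[ b ] part p a ≡ part q b

_≋_ : ∀ {n k} → Rel (𝒫 n k) 0ℓ
p ≋ q = p ⊑ q × q ⊑ p

⊑-trans : ∀ {n k} {p q r : 𝒫 n k} → p ⊑ q → q ⊑ r → p ⊑ r
⊑-trans f g a with f a
... | b , e with g b
... | c , e′ = c , trans e e′

𝒫-setoid : ℕ → ℕ → Setoid 0ℓ 0ℓ
𝒫-setoid n k = record
  { Carrier = 𝒫 n k
  ; _≈_ = _≋_
  ; isEquivalence = record
    { refl  = (λ a → a , refl) , (λ a → a , refl)
    ; sym   = λ (f , g) → g , f
    ; trans = λ {p} {q} {r} (f , g) (f′ , g′) →
        ⊑-trans {p = p} {q} {r} f f′ , ⊑-trans {p = r} {q} {p} g′ g
    }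
  }

SamePart : ∀ {n k} → 𝒫 n k → Fin n → Fin n → Set
SamePart p i j = ∃[ a ] i ∈ part p a × j ∈ part p a

-- This forces c ≤ k, since distinct parts receive distinct symbols.
_Represents_ : ∀ {k m c} → Vec (Fin k) m → 𝒫 m c → Set
r Represents p = ∀ i j → lookup r i ≡ lookup r j ⇔ SamePart p i j

SamePart-resp : ∀ {n k} {p q : 𝒫 n k} → p ⊑ q →
                ∀ {i j} → SamePart p i j → SamePart q i j
SamePart-resp f (a , i∈ , j∈) with f a
... | b , e = b , subst (_ ∈_) e i∈ , subst (_ ∈_) e j∈

Represents-resp : ∀ {k m c} (r : Vec (Fin k) m) {p q : 𝒫 m c} →
                  p ≋ q → r Represents p → r Represents q
Represents-resp r {p} {q} (f , g) ρ i j = mk⇔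
  (λ e → SamePart-resp {p = p} {q} f (Equivalence.to (ρ i j) e))
  (λ s → Equivalence.from (ρ i j) (SamePart-resp {p = q} {p} g s))

vertexSetoid : ℕ → ℕ → Setoid 0ℓ 0ℓ
vertexSetoid n k = ⊎-setoid (𝒫-setoid (n ∸ 1) k) (𝒫-setoid (n ∸ 1) (k ∸ 1))

TVertex : ℕ → ℕ → Set
TVertex n k = Setoid.Carrier (vertexSetoid n k)

RepresentsVertex : ∀ n k → Vec (Fin k) (n ∸ 1) → TVertex n k → Set
RepresentsVertex n k r v = [ r Represents_ , r Represents_ ] v

-- When tail r ≡ init s, overlaying r and s at that common substring gives
-- head r ∷ s.  Only n ≥ 2 is meaningful; for smaller n there are no edges.
TEdge : ∀ n k → Rel (TVertex n k) 0ℓ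
TEdge n@(2+ l) k v w =
  ∃[ r ] ∃[ s ] RepresentsVertex n k r v × RepresentsVertex n k s w ×
    tail r ≡ init s ×
    ∃ λ (p : 𝒫 n k) → (head r ∷ s) Represents p
TEdge _ _ _ _ = ⊥

RepresentsVertex-resp : ∀ n k (r : Vec (Fin k) (n ∸ 1)) {v w : TVertex n k} →
                        Setoid._≈_ (vertexSetoid n k) v w →
                        RepresentsVertex n k r v → RepresentsVertex n k r w
RepresentsVertex-resp n k r (inj₁ {p} {q} e) = Represents-resp r {p} {q} e
RepresentsVertex-resp n k r (inj₂ {p} {q} e) = Represents-resp r {p} {q} e

TEdge-resp : ∀ n k → TEdge n k Respects₂ Setoid._≈_ (vertexSetoid n k)
TEdge-resp 0 k = (λ _ ()) , (λ _ ())
TEdge-resp 1 k = (λ _ ()) , (λ _ ())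
TEdge-resp n@(2+ _) k =
    (λ e (r , s , ρ , σ , h) → r , s , ρ , RepresentsVertex-resp n k s e σ , h)
  , (λ e (r , s , ρ , σ , h) → r , s , RepresentsVertex-resp n k r e ρ , σ , h)

transitionDigraph : ℕ → ℕ → Digraph
transitionDigraph n k = record
  { vertices = vertexSetoid n k
  ; Edge     = TEdge n k
  ; resp     = TEdge-resp n k
  }

{-# OPTIONS --safe #-}

-- An arc of G(n,k) is a surjective word of length n over [k] up to renaming of symbols, and
-- the target of an arc is the source of its cyclic rotation.  The rotation orbits are therefore
-- closed walks which partition the arcs.  Changing the last symbol of a word does not affect
-- the source, so two orbits containing words that differ in one symbol only can be spliced at a
-- common vertex.  Since any two surjective words are connected by renamings and single changes
-- that stay surjective, splicing along such paths yields one closed walk through all arcs.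
module Submission where

open import Data.Fin using (Fin; zero; suc; toℕ; inject₁; fromℕ; punchIn; punchOut)
open import Data.Fin.Induction using (<-weakInduction)
open import Data.Fin.Properties
  using (_≟_; any?; all?; injective⇒≤; pigeonhole; punchInᵢ≢i; punchOut-cong;
         punchOut-injective; punchOut-punchIn; <⇒≢; toℕ-fromℕ; toℕ-inject₁)
open import Data.Fin.Relation.Unary.Top using (view; view-fromℕ; view-inject₁; ‵fromℕ; ‵inject₁)
open import Data.Fin.Subset using (Subset; _∈_)
open import Data.Fin.Subset.Properties using (⊆-antisym)
open import Data.List as List using (List; []; _∷_; _++_; applyUpTo)
import Data.List.Membership.Setoid as Membership
import Data.List.Membership.DecSetoid as DecMembership
import Data.List.Membership.Setoid.Properties as Membershipₚ
import Data.List.Membership.Propositional as Membership≡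
import Data.List.Membership.Propositional.Properties as Membership≡ₚ
import Data.List.Relation.Binary.Permutation.Setoid as Permutation
import Data.List.Relation.Binary.Permutation.Setoid.Properties as Permutationₚ
open import Data.List.Relation.Unary.AllPairs using (_∷_)
import Data.List.Relation.Unary.All as All
open import Data.List.Relation.Unary.Any as Any using (here; there)
import Data.List.Relation.Unary.Any.Properties as Anyₚ
import Data.List.Relation.Unary.Unique.Setoid as Uniqueness
import Data.List.Relation.Unary.Unique.Setoid.Properties as Uniquenessₚ
open import Data.Nat as ℕ using (ℕ; zero; suc; 2+; _≤_; _<_; s≤s; _≤′_; ≤′-refl; ≤′-step)
open import Data.Nat.GeneralisedArithmetic using (fold; fold-+)
import Data.Nat.Properties as ℕₚ
open import Data.Product using (_×_; _,_; ∃-syntax; ∃₂; ∃!; Σ-syntax; proj₁; proj₂)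
open import Data.Sum using (inj₁; inj₂; [_,_])
open import Data.Sum.Relation.Binary.Pointwise using (inj₁; inj₂)
open import Data.Vec using (Vec; []; _∷_; lookup; tabulate; init)
import Data.Vec.Functional as F
open import Data.Vec.Functional.Properties using (updateAt-updates; updateAt-minimal)
open import Data.Vec.Properties using (lookup∘tabulate; lookup⇒[]=; []=⇒lookup)
open import Function using (_∘_; _⇔_; mk⇔; Equivalence; Injective; StrictlySurjective; const; id)
open import Level using (0ℓ)
open import Relation.Binary using (DecSetoid; Rel; Setoid)
open import Relation.Binary.Construct.Closure.ReflexiveTransitive as Star using (Star; ε; _◅_; _◅◅_)
open import Relation.Binary.PropositionalEquality
  using (_≡_; _≢_; _≗_; refl; sym; trans; cong; subst; module ≡-Reasoning)
open import Relation.Nullary using (Dec; yes; no; does; ¬_; contradiction)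
open import Relation.Nullary.Decidable using (map′; _×-dec_; _→-dec_; dec-true)
open import Relation.Unary using (Pred; Decidable)
open import Defs

-- Rotations acting on the arcs of a digraph.

-- A rotation-invariant tour contains an arc as soon as it contains some rotation of it, so it
-- suffices that some simultaneous rotations of the two arcs have a common source.
data Link {A : Set} (_∼_ : Rel A 0ℓ) (σ : A → A) (x y : A) : Set where
  fork : x ∼ y → Link _∼_ σ x y
  turn : Link _∼_ σ (σ x) (σ y) → Link _∼_ σ x y

-- Targets are derived from `src` and `σ`, which makes each orbit of `σ` a closed walk. The fields
-- `arc-edge`, `edge-arc` and `arc-unique` identify arcs up to `_≈ₐ_` with edges up to equality of
-- their endpoints.
record ArcRotation (G : Digraph) : Set₁ where
  open Digraph G public
  field
    arcs : DecSetoid 0ℓ 0ℓ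
  open DecSetoid arcs public
    using () renaming (Carrier to Arc; _≈_ to _≈ₐ_; _≟_ to _≟ₐ_; setoid to arcSetoid)
  open Membership arcSetoid public using () renaming (_∈_ to _∈ₐ_)
  field
    src      : Arc → Vertex
    src-cong : ∀ {e f} → e ≈ₐ f → src e ≈ src f
    σ        : Arc → Arc
    σ-cong   : ∀ {e f} → e ≈ₐ f → σ e ≈ₐ σ f

  tgt : Arc → Vertex
  tgt = src ∘ σ

  field
    period-1   : ℕ
    periodic   : ∀ e → fold e σ (suc period-1) ≈ₐ e
    arc-edge   : ∀ e → Edge (src e) (tgt e)
    edge-arc   : ∀ {v w} → Edge v w → ∃[ e ] src e ≈ v × tgt e ≈ w
    arc-unique : ∀ {e f} → src e ≈ src f → tgt e ≈ tgt f → e ≈ₐ f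
    all        : List Arc
    all-∈      : ∀ e → e ∈ₐ all
    base       : Arc
    connected  : ∀ e → Star (Link (λ f g → src f ≈ src g) σ) base e

least : {P : Pred ℕ 0ℓ} → Decidable P → ∀ m → P m → ∃[ i ] P i × (∀ {j} → j < i → ¬ P j)
least P? zero    p = zero , p , λ ()
least P? (suc m) p with P? zero
... | yes p₀ = zero , p₀ , λ ()
... | no ¬p₀ with least (P? ∘ suc) m p
... | i , pᵢ , min = suc i , pᵢ , λ { {zero} _ → ¬p₀ ; {suc _} (s≤s j<i) → min j<i }

fold-suc : ∀ {A : Set} (s : A → A) z n → fold (s z) s n ≡ s (fold z s n)
fold-suc s z zero    = refl
fold-suc s z (suc n) = cong s (fold-suc s z n)

-- Splicing the orbits into an Eulerian cycle.

module Eulerian {G : Digraph} (R : ArcRotation G) where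
  open ArcRotation R
  open Setoid vertices using ()
    renaming (refl to ≈-refl; sym to ≈-sym; trans to ≈-trans)
  open DecSetoid arcs using ()
    renaming (refl to ≈ₐ-refl; sym to ≈ₐ-sym; trans to ≈ₐ-trans; reflexive to ≈ₐ-reflexive)
  open DecMembership arcs using (_∈?_)
  open Membershipₚ using (∈-resp-≈; ∈-++⁺ˡ; ∈-++⁺ʳ; ∈-++⁻; ∈-applyUpTo⁺; ∈-applyUpTo⁻)
  open Permutation arcSetoid using (_↭_; prep; ↭-refl; ↭-sym; ↭-trans)
  open Permutationₚ arcSetoid using (∈-resp-↭; Unique-resp-↭; shift)
  open Uniqueness arcSetoid using (Unique)

  tgt-cong : ∀ {e f} → e ≈ₐ f → tgt e ≈ tgt f
  tgt-cong = src-cong ∘ σ-cong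

  Walk : Vertex → List Arc → Vertex → Set
  Walk u []       w = u ≈ w
  Walk u (e ∷ es) w = u ≈ src e × Walk (tgt e) es w

  Walk-respˡ : ∀ {u v w} es → u ≈ v → Walk v es w → Walk u es w
  Walk-respˡ []       u≈v p       = ≈-trans u≈v p
  Walk-respˡ (e ∷ es) u≈v (p , q) = ≈-trans u≈v p , q

  Walk-respʳ : ∀ {u v w} es → Walk u es v → v ≈ w → Walk u es w
  Walk-respʳ []       p       q = ≈-trans p q
  Walk-respʳ (_ ∷ es) (p , r) q = p , Walk-respʳ es r q

  applyUpTo-walk : ∀ (g : ℕ → Arc) → (∀ i → g (suc i) ≡ σ (g i)) →
                   ∀ n → Walk (src (g 0)) (applyUpTo g n) (src (g n))
  applyUpTo-walk g p zero    = ≈-refl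
  applyUpTo-walk g p (suc n) = ≈-refl ,
    subst (λ f → Walk (src f) (applyUpTo (g ∘ suc) n) (src (g (suc n)))) (p 0)
      (applyUpTo-walk (g ∘ suc) (p ∘ suc) n)

  Walk-++ : ∀ {u v w} es {fs} → Walk u es v → Walk v fs w → Walk u (es ++ fs) w
  Walk-++ []       {fs} p  q = Walk-respˡ fs p q
  Walk-++ (e ∷ es) (p , r) q = p , Walk-++ es r q

  -- The closed walk `fs` is inserted just before the occurrence of `e`, where `es` passes through
  -- `v`. A permutation is all that later steps have to know about the result.
  splice : ∀ {u v w e fs} es → Walk u es w → e ∈ₐ es → src e ≈ v → Walk v fs v →
           ∃[ gs ] Walk u gs w × gs ↭ fs ++ es
  splice {fs = fs} (e ∷ es) (p , q) (here e≈) s c =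
    fs ++ e ∷ es ,
    Walk-respˡ (fs ++ e ∷ es) u≈v (Walk-++ fs c (≈-trans (≈-sym u≈v) p , q)) ,
    ↭-refl
    where u≈v = ≈-trans p (≈-trans (≈-sym (src-cong e≈)) s)
  splice {fs = fs} (e ∷ es) (p , q) (there e∈) s c with splice es q e∈ s c
  ... | gs , r , π = e ∷ gs , (p , r) ,
    ↭-trans (prep ≈ₐ-refl π) (↭-sym (shift ≈ₐ-refl fs es))

  fold-cong : ∀ n {e f} → e ≈ₐ f → fold e σ n ≈ₐ fold f σ n
  fold-cong zero    = id
  fold-cong (suc n) = σ-cong ∘ fold-cong n

  -- Since a positive iterate of `σ` is the identity, the iterate before it inverts `σ`. Injectivity
  -- of `σ` and backward closure of tours both come from this.
  σ-inverse : ∀ e → fold (σ e) σ period-1 ≈ₐ e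
  σ-inverse e = ≈ₐ-trans (≈ₐ-reflexive (fold-suc σ e period-1)) (periodic e)

  σ-injective : ∀ {e f} → σ e ≈ₐ σ f → e ≈ₐ f
  σ-injective {e} {f} p =
    ≈ₐ-trans (≈ₐ-sym (σ-inverse e)) (≈ₐ-trans (fold-cong period-1 p) (σ-inverse f))

  fold-injective : ∀ n {e f} → fold e σ n ≈ₐ fold f σ n → e ≈ₐ f
  fold-injective zero    = id
  fold-injective (suc n) = fold-injective n ∘ σ-injective

  module Orbit (e : Arc) where
    -- A word with a rotational symmetry returns before the common period is over, so an orbit has
    -- to stop at its own least period to be free of repetitions.
    least-period : ∃[ m ] fold e σ (suc m) ≈ₐ e × (∀ {j} → j < m → ¬ fold e σ (suc j) ≈ₐ e)
    least-period = least (λ m → fold e σ (suc m) ≟ₐ e) period-1 (periodic e)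

    m : ℕ
    m = proj₁ least-period

    orbit : List Arc
    orbit = applyUpTo (fold e σ) (suc m)

    e∈orbit : e ∈ₐ orbit
    e∈orbit = here ≈ₐ-refl

    orbit-closed : ∀ {f} → f ∈ₐ orbit → σ f ∈ₐ orbit
    orbit-closed f∈ with ∈-applyUpTo⁻ arcSetoid (fold e σ) f∈
    ... | i , s≤s i≤m , f≈ with ℕₚ.m≤n⇒m<n∨m≡n i≤m
    ... | inj₁ i<m  = ∈-resp-≈ arcSetoid (≈ₐ-sym (σ-cong f≈))
                        (∈-applyUpTo⁺ arcSetoid (fold e σ) (s≤s i<m))
    -- The last arc of the orbit rotates back to `e`.
    ... | inj₂ refl = here (≈ₐ-trans (σ-cong f≈) (proj₁ (proj₂ least-period)))

    -- If the entries at `i < j` agreed, cancelling `i` rotations would bring `e` back after `j ∸ i`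
    -- steps, before its least period.
    orbit-unique : Unique orbit
    orbit-unique = Uniquenessₚ.applyUpTo⁺₁ arcSetoid (fold e σ) (suc m) distinct
      where
      distinct : ∀ {i j} → i < j → j < suc m → ¬ fold e σ i ≈ₐ fold e σ j
      distinct {i} i<j (s≤s j≤m) eq with ℕₚ.m≤n⇒∃[o]m+o≡n i<j
      ... | d , refl = proj₂ (proj₂ least-period)
        (ℕₚ.≤-trans (s≤s (ℕₚ.m≤n+m d i)) j≤m)
        (≈ₐ-sym (fold-injective i (≈ₐ-trans eq (≈ₐ-reflexive
          (trans (cong (fold e σ) (sym (ℕₚ.+-suc i d))) (fold-+ e σ i))))))

    orbit-walk : Walk (src e) orbit (src e)
    orbit-walk = Walk-respʳ orbit (applyUpTo-walk (fold e σ) (λ _ → refl) (suc m))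
      (src-cong (proj₁ (proj₂ least-period)))

  open Orbit using (orbit; e∈orbit; orbit-closed; orbit-unique; orbit-walk)

  -- Closure under `σ` is kept as an invariant because it forces every orbit to lie inside the tour
  -- or to be disjoint from it.
  record Tour (es : List Arc) : Set where
    field
      start  : Vertex
      cyclic : Walk start es start
      unique : Unique es
      σ⁺     : ∀ {e} → e ∈ₐ es → σ e ∈ₐ es

    fold⁺ : ∀ n {e} → e ∈ₐ es → fold e σ n ∈ₐ es
    fold⁺ zero    = id
    fold⁺ (suc n) = σ⁺ ∘ fold⁺ n

    σ⁻ : ∀ {e} → σ e ∈ₐ es → e ∈ₐ es
    σ⁻ {e} p = ∈-resp-≈ arcSetoid (σ-inverse e) (fold⁺ period-1 p)

    fold⁻ : ∀ n {e} → fold e σ n ∈ₐ es → e ∈ₐ es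
    fold⁻ zero    = id
    fold⁻ (suc n) = fold⁻ n ∘ σ⁻

  open Tour

  orbit-tour : ∀ e → Tour (orbit e)
  orbit-tour e = record
    { start = src e ; cyclic = orbit-walk e ; unique = orbit-unique e ; σ⁺ = orbit-closed e }

  Extension : List Arc → Arc → Set
  Extension es f = ∃[ gs ] Tour gs × (∀ {e} → e ∈ₐ es → e ∈ₐ gs) × f ∈ₐ gs

  join : ∀ {es e f} → Tour es → e ∈ₐ es → src e ≈ src f → Extension es f
  join {es} {e} {f} T e∈ e≈f with f ∈? es
  ... | yes f∈ = es , T , id , f∈
  ... | no  f∉ with splice es (cyclic T) e∈ e≈f (orbit-walk f)
  ... | gs , c , π = gs , record
    { start  = start T
    ; cyclic = c
    ; unique = Unique-resp-↭ (↭-sym π)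
        (Uniquenessₚ.++⁺ arcSetoid (orbit-unique f) (unique T) disjoint)
    ; σ⁺     = λ p → [ back ∘ ∈-++⁺ˡ arcSetoid ∘ orbit-closed f
                     , back ∘ ∈-++⁺ʳ arcSetoid (orbit f) ∘ σ⁺ T
                     ] (∈-++⁻ arcSetoid (orbit f) (∈-resp-↭ π p))
    } , back ∘ ∈-++⁺ʳ arcSetoid (orbit f) , back (∈-++⁺ˡ arcSetoid (e∈orbit f))
    where
    back : ∀ {g} → g ∈ₐ orbit f ++ es → g ∈ₐ gs
    back = ∈-resp-↭ (↭-sym π)
    -- A common arc is an iterate of `f`; rotating it back inside the tour would put `f` there too.
    disjoint : ∀ {g} → ¬ (g ∈ₐ orbit f × g ∈ₐ es)
    disjoint (g∈o , g∈es) with ∈-applyUpTo⁻ arcSetoid (fold f σ) g∈o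
    ... | i , _ , g≈ = f∉ (fold⁻ T i (∈-resp-≈ arcSetoid g≈ g∈es))

  _—_ : Rel Arc 0ℓ
  _—_ = Link (λ e f → src e ≈ src f) σ

  extend : ∀ {es e f} → Tour es → e ∈ₐ es → e — f → Extension es f
  extend T e∈ (fork e≈f) = join T e∈ e≈f
  extend T e∈ (turn l) with extend T (σ⁺ T e∈) l
  ... | gs , T′ , es⊆ , f∈ = gs , T′ , es⊆ , σ⁻ T′ f∈

  reach : ∀ {es e f} → Tour es → e ∈ₐ es → Star _—_ e f → Extension es f
  reach T e∈ ε = _ , T , id , e∈
  reach T e∈ (l ◅ ls) with extend T e∈ l
  ... | gs , T′ , es⊆ , f∈ with reach T′ f∈ ls
  ... | hs , T″ , gs⊆ , g∈ = hs , T″ , gs⊆ ∘ es⊆ , g∈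

  -- Each arc of `fs` is reached along its own path from `base`, and the tour only grows, so `base`
  -- and the arcs absorbed earlier stay in it.
  absorb : ∀ {es} fs → Tour es → base ∈ₐ es →
           ∃[ gs ] Tour gs × (∀ {e} → e ∈ₐ es → e ∈ₐ gs) × (∀ {f} → f ∈ₐ fs → f ∈ₐ gs)
  absorb []       T _  = _ , T , id , λ ()
  absorb (f ∷ fs) T b∈ with reach T b∈ (connected f)
  ... | gs , T′ , es⊆ , f∈ with absorb fs T′ (es⊆ b∈)
  ... | hs , T″ , gs⊆ , fs⊆ = hs , T″ , gs⊆ ∘ es⊆ , λ
    { (here e≈f) → gs⊆ (∈-resp-≈ arcSetoid (≈ₐ-sym e≈f) f∈)
    ; (there e∈) → fs⊆ e∈ }

  visit : ∀ {u w} es → Walk u es w → Fin (suc (List.length es)) → Vertex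
  visit {u} es       _       zero    = u
  visit     (_ ∷ es) (_ , p) (suc i) = visit es p i

  visit-src : ∀ {u w} es (p : Walk u es w) i → visit es p (inject₁ i) ≈ src (List.lookup es i)
  visit-src (_ ∷ es) (p , _) zero    = p
  visit-src (_ ∷ es) (_ , p) (suc i) = visit-src es p i

  visit-tgt : ∀ {u w} es (p : Walk u es w) i → visit es p (suc i) ≈ tgt (List.lookup es i)
  visit-tgt (_ ∷ es) (_ , p) zero    = ≈-refl
  visit-tgt (_ ∷ es) (_ , p) (suc i) = visit-tgt es p i

  visit-end : ∀ {u w} es (p : Walk u es w) → visit es p (fromℕ (List.length es)) ≈ w
  visit-end []       p       = p
  visit-end (_ ∷ es) (_ , p) = visit-end es p

  lookup-injective : ∀ {es} → Unique es → ∀ i j → List.lookup es i ≈ₐ List.lookup es j → i ≡ j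
  lookup-injective (_  ∷ _) zero    zero    _ = refl
  lookup-injective (e∉ ∷ _) zero    (suc j) p =
    contradiction p (All.lookup e∉ (Membership≡ₚ.∈-lookup j))
  lookup-injective (e∉ ∷ _) (suc i) zero    p =
    contradiction (≈ₐ-sym p) (All.lookup e∉ (Membership≡ₚ.∈-lookup i))
  lookup-injective (_  ∷ u) (suc i) (suc j) p = cong suc (lookup-injective u i j p)

  eulerianCycle : EulerianCycle G
  eulerianCycle with absorb all (orbit-tour base) (e∈orbit base)
  ... | es , T , _ , all⊆ = record
    { length = List.length es
    ; walk   = visit es (cyclic T)
    ; closed = ≈-sym (visit-end es (cyclic T))
    ; step   = λ i → proj₂ resp (≈-sym (visit-src es (cyclic T) i))
        (proj₁ resp (≈-sym (visit-tgt es (cyclic T) i)) (arc-edge (List.lookup es i)))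
    ; once   = once
    }
    where
    once : ∀ {v w} → Edge v w → ∃! _≡_ λ i →
           visit es (cyclic T) (inject₁ i) ≈ v × visit es (cyclic T) (suc i) ≈ w
    once {v} {w} vw with edge-arc vw
    ... | e , src≈v , tgt≈w =
      Any.index e∈ ,
      ( ≈-trans (visit-src es (cyclic T) _) (≈-trans (≈-sym (src-cong e≈)) src≈v)
      , ≈-trans (visit-tgt es (cyclic T) _) (≈-trans (≈-sym (tgt-cong e≈)) tgt≈w)) ,
      -- By `arc-unique` the arc at any such `j` is `e`, and a tour lists `e` only once.
      λ {j} (p , q) → lookup-injective (unique T) _ j
        (≈ₐ-trans (≈ₐ-sym e≈)
          (arc-unique (≈-trans src≈v (≈-trans (≈-sym p) (visit-src es (cyclic T) j)))
                      (≈-trans tgt≈w (≈-trans (≈-sym q) (visit-tgt es (cyclic T) j)))))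
      where
      e∈ : e ∈ₐ es
      e∈ = all⊆ (all-∈ e)
      e≈ : e ≈ₐ List.lookup es (Any.index e∈)
      e≈ = Anyₚ.lookup-index e∈

-- Functions with the same kernel.

infix 4 _∼_

record _∼_ {X A B : Set} (f : X → A) (g : X → B) : Set where
  constructor mk∼
  field kernel : ∀ x y → f x ≡ f y ⇔ g x ≡ g y

  to : ∀ {x y} → f x ≡ f y → g x ≡ g y
  to = Equivalence.to (kernel _ _)

  from : ∀ {x y} → g x ≡ g y → f x ≡ f y
  from = Equivalence.from (kernel _ _)

open _∼_

module _ {X : Set} where
  ≗⇒∼ : ∀ {A : Set} {f g : X → A} → f ≗ g → f ∼ g
  ≗⇒∼ f≗g = mk∼ λ x y → mk⇔
    (λ p → trans (sym (f≗g x)) (trans p (f≗g y)))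
    (λ p → trans (f≗g x) (trans p (sym (f≗g y))))

  ∼-sym : ∀ {A B : Set} {f : X → A} {g : X → B} → f ∼ g → g ∼ f
  ∼-sym p = mk∼ λ _ _ → mk⇔ (from p) (to p)

  ∼-trans : ∀ {A B C : Set} {f : X → A} {g : X → B} {h : X → C} → f ∼ g → g ∼ h → f ∼ h
  ∼-trans p q = mk∼ λ _ _ → mk⇔ (to q ∘ to p) (from p ∘ from q)

  ∼-∘ : ∀ {Y A B : Set} {f : X → A} {g : X → B} (r : Y → X) → f ∼ g → f ∘ r ∼ g ∘ r
  ∼-∘ r p = mk∼ λ _ _ → mk⇔ (to p) (from p)

  injective⇒∼ : ∀ {A B : Set} {f : X → A} {g : X → B} →
                Injective _≡_ _≡_ f → Injective _≡_ _≡_ g → f ∼ g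
  injective⇒∼ {f = f} {g} f-inj g-inj = mk∼ λ _ _ → mk⇔ (cong g ∘ f-inj) (cong f ∘ g-inj)

∼? : ∀ {n k} (f g : Fin n → Fin k) → Dec (f ∼ g)
∼? f g = map′ mk∼ kernel (all? λ i → all? λ j →
  map′ (λ (p , q) → mk⇔ p q) (λ e → Equivalence.to e , Equivalence.from e)
    (((f i ≟ f j) →-dec (g i ≟ g j)) ×-dec ((g i ≟ g j) →-dec (f i ≟ f j))))

-- Surjections between finite sets.

Onto : ∀ {n k} → (Fin n → Fin k) → Set
Onto = StrictlySurjective _≡_

onto? : ∀ {n k} (f : Fin n → Fin k) → Dec (Onto f)
onto? f = all? λ b → any? λ i → f i ≟ b

-- Punching out a missed value would inject `Fin (suc n)` into `Fin n`.
injective⇒onto : ∀ {n} {f : Fin n → Fin n} → Injective _≡_ _≡_ f → Onto f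
injective⇒onto {suc n} {f} f-inj b with any? (λ i → f i ≟ b)
... | yes hit = hit
... | no miss = contradiction
  (injective⇒≤ {f = λ i → punchOut (b≢f i)} λ p → f-inj (punchOut-injective (b≢f _) (b≢f _) p))
  ℕₚ.1+n≰n
  where
  b≢f : ∀ i → b ≢ f i
  b≢f i p = miss (i , sym p)

-- A section of `f` is injective, hence onto, so `x` and `y` are both values of the section, and `f`
-- recovers where they come from.
onto⇒injective : ∀ {n} {f : Fin n → Fin n} → Onto f → Injective _≡_ _≡_ f
onto⇒injective {n} {f} onto {x} {y} fx≡fy with
  injective⇒onto section-injective x | injective⇒onto section-injective y
  where
  section-injective : Injective _≡_ _≡_ (λ b → proj₁ (onto b))
  section-injective {b} {c} p = trans (sym (proj₂ (onto b))) (trans (cong f p) (proj₂ (onto c)))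
... | b , refl | c , refl =
  cong (λ d → proj₁ (onto d)) (trans (sym (proj₂ (onto b))) (trans fx≡fy (proj₂ (onto c))))

-- Both alphabets have `k` symbols, and `g` after a section of `f` is an injective self-map of
-- `Fin k`.
Onto-resp-∼ : ∀ {n k} {f g : Fin n → Fin k} → f ∼ g → Onto f → Onto g
Onto-resp-∼ {f = f} {g} f∼g onto b with injective⇒onto g∘section-injective b
  where
  g∘section-injective : Injective _≡_ _≡_ (λ c → g (proj₁ (onto c)))
  g∘section-injective {c} {d} p =
    trans (sym (proj₂ (onto c))) (trans (from f∼g p) (proj₂ (onto d)))
... | c , p = proj₁ (onto c) , p

-- Partitions as kernels of labellings.

Labels : ∀ {m c} {A : Set} → (Fin m → A) → 𝒫 m c → Set
Labels f p = ∀ i j → f i ≡ f j ⇔ SamePart p i j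

Labels-resp-∼ : ∀ {m c} {A B : Set} {f : Fin m → A} {g : Fin m → B} →
                f ∼ g → {p : 𝒫 m c} → Labels f p → Labels g p
Labels-resp-∼ f∼g ℓ i j = mk⇔
  (Equivalence.to (ℓ i j) ∘ from f∼g) (to f∼g ∘ Equivalence.from (ℓ i j))

Labels-∼ : ∀ {m c} {A B : Set} {f : Fin m → A} {g : Fin m → B} (p : 𝒫 m c) →
           Labels f p → Labels g p → f ∼ g
Labels-∼ p ℓ ℓ′ = mk∼ λ i j → mk⇔
  (Equivalence.from (ℓ′ i j) ∘ Equivalence.to (ℓ i j))
  (Equivalence.from (ℓ i j) ∘ Equivalence.to (ℓ′ i j))

module _ {m c} (p : 𝒫 m c) where
  open 𝒫 p

  index : Fin m → Fin c
  index i = proj₁ (cover i)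

  index-labels : Labels index p
  index-labels i j = mk⇔
    (λ e → index j , subst (λ a → i ∈ part a) e (proj₂ (cover i)) , proj₂ (cover j))
    (λ (a , i∈ , j∈) → trans (disjoint (proj₂ (cover i)) i∈) (disjoint j∈ (proj₂ (cover j))))

  index-onto : Onto index
  index-onto a = proj₁ (nonempty a) , disjoint (proj₂ (cover _)) (proj₂ (nonempty a))

  ∈-part⁺ : ∀ {i a} → index i ≡ a → i ∈ part a
  ∈-part⁺ {i} refl = proj₂ (cover i)

  ∈-part⁻ : ∀ {i a} → i ∈ part a → index i ≡ a
  ∈-part⁻ {i} = disjoint (proj₂ (cover i))

index-∼ : ∀ {m c d} {A B : Set} {f : Fin m → A} {g : Fin m → B} (p : 𝒫 m c) (q : 𝒫 m d) →
          Labels f p → Labels g q → f ∼ g → index p ∼ index q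
index-∼ p q ℓ ℓ′ f∼g =
  ∼-trans (Labels-∼ p (index-labels p) ℓ) (∼-trans f∼g (Labels-∼ q ℓ′ (index-labels q)))

∼⇒⊑ : ∀ {m c} (p q : 𝒫 m c) → index p ∼ index q → p ⊑ q
∼⇒⊑ p q e a with index-onto p a
... | i , refl = index q i , ⊆-antisym
  (λ j∈ → ∈-part⁺ q (to e (∈-part⁻ p j∈)))
  (λ j∈ → ∈-part⁺ p (from e (∈-part⁻ q j∈)))

-- Choosing an element in each part of `p` and taking its part in `q` is injective. This keeps the
-- two kinds of vertices apart.
∼⇒parts≤ : ∀ {m c d} (p : 𝒫 m c) (q : 𝒫 m d) → index p ∼ index q → c ≤ d
∼⇒parts≤ p q e = injective⇒≤ {f = λ a → index q (proj₁ (index-onto p a))} λ {a} {b} eq →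
  trans (sym (proj₂ (index-onto p a))) (trans (from e eq) (proj₂ (index-onto p b)))

module _ {m c} (f : Fin m → Fin c) (onto : Onto f) where

  fibre : Fin c → Subset m
  fibre a = tabulate λ i → does (f i ≟ a)

  ∈-fibre⁺ : ∀ {i a} → f i ≡ a → i ∈ fibre a
  ∈-fibre⁺ {i} {a} p = lookup⇒[]= i (fibre a)
    (trans (lookup∘tabulate _ i) (dec-true (f i ≟ a) p))

  ∈-fibre⁻ : ∀ {i a} → i ∈ fibre a → f i ≡ a
  ∈-fibre⁻ {i} {a} p
    with f i ≟ a | trans (sym (lookup∘tabulate (λ i → does (f i ≟ a)) i)) ([]=⇒lookup p)
  ... | yes q | _  = q
  ... | no _  | ()

  fibres : 𝒫 m c
  fibres = record
    { part     = fibre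
    ; nonempty = λ a → proj₁ (onto a) , ∈-fibre⁺ (proj₂ (onto a))
    ; disjoint = λ i∈a i∈b → trans (sym (∈-fibre⁻ i∈a)) (∈-fibre⁻ i∈b)
    ; cover    = λ i → f i , ∈-fibre⁺ refl
    }

  fibres-labels : Labels f fibres
  fibres-labels i j = mk⇔
    (λ p → f j , ∈-fibre⁺ p , ∈-fibre⁺ refl)
    (λ (a , i∈ , j∈) → trans (∈-fibre⁻ i∈) (sym (∈-fibre⁻ j∈)))

-- The cyclic successor of positions.

next : ∀ {n} → Fin (suc n) → Fin (suc n)
next i with view i
... | ‵fromℕ     = zero
... | ‵inject₁ j = suc j

next-fromℕ : ∀ n → next (fromℕ n) ≡ zero
next-fromℕ n rewrite view-fromℕ n = refl

next-inject₁ : ∀ {n} (i : Fin n) → next (inject₁ i) ≡ suc i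
next-inject₁ i rewrite view-inject₁ i = refl

next-onto : ∀ {n} → Onto (next {n})
next-onto {n} zero = fromℕ n , next-fromℕ n
next-onto (suc i)  = inject₁ i , next-inject₁ i

next-injective : ∀ {n} → Injective _≡_ _≡_ (next {n})
next-injective = onto⇒injective next-onto

fold-next-toℕ : ∀ {n} (i : Fin (suc n)) → fold zero next (toℕ i) ≡ i
fold-next-toℕ = <-weakInduction (λ i → fold zero next (toℕ i) ≡ i) refl λ i p →
  trans (cong next (trans (cong (fold zero next) (sym (toℕ-inject₁ i))) p)) (next-inject₁ i)

-- Every position is an iterate of `next` at `zero`, and iterates commute, so it is enough that
-- `zero` returns: `n` steps lead to the last position and one more to `zero`.
next-periodic : ∀ {n} (i : Fin (suc n)) → fold i next (suc n) ≡ i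
next-periodic {n} i = begin
  fold i next (suc n)                          ≡⟨ cong (λ j → fold j next (suc n)) (fold-next-toℕ i) ⟨
  fold (fold zero next (toℕ i)) next (suc n)   ≡⟨ fold-+ zero next (suc n) ⟨
  fold zero next (suc n ℕ.+ toℕ i)             ≡⟨ cong (fold zero next) (ℕₚ.+-comm (suc n) (toℕ i)) ⟩
  fold zero next (toℕ i ℕ.+ suc n)             ≡⟨ fold-+ zero next (toℕ i) ⟩
  fold (fold zero next (suc n)) next (toℕ i)   ≡⟨ cong (λ j → fold j next (toℕ i)) next-turn ⟩
  fold zero next (toℕ i)                       ≡⟨ fold-next-toℕ i ⟩
  i                                            ∎
  where
  open ≡-Reasoning
  next-turn : fold zero next (suc n) ≡ zero
  next-turn = begin
    next (fold zero next n)                ≡⟨ cong (next ∘ fold zero next) (toℕ-fromℕ n) ⟨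
    next (fold zero next (toℕ (fromℕ n)))  ≡⟨ cong next (fold-next-toℕ (fromℕ n)) ⟩
    next (fromℕ n)                         ≡⟨ next-fromℕ n ⟩
    zero                                   ∎

next-inject₁-∼ : ∀ {n} {A : Set} (f : Fin (suc n) → A) → f ∘ next ∘ inject₁ ∼ f ∘ suc
next-inject₁-∼ f = ≗⇒∼ (cong f ∘ next-inject₁)

-- Surjective words, their rotation and their enumeration.

Word : ℕ → ℕ → Set
Word n k = Σ[ f ∈ (Fin n → Fin k) ] Onto f

rotate : ∀ {n k} → Word (suc n) k → Word (suc n) k
rotate (f , onto) = f ∘ next , λ b →
  let i , p = onto b ; j , q = next-onto i in j , trans (cong f q) p

fold-rotate : ∀ {n k} (e : Word (suc n) k) t i →
              proj₁ (fold e rotate t) i ≡ proj₁ e (fold i next t)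
fold-rotate e zero    i = refl
fold-rotate e (suc t) i =
  trans (fold-rotate e t (next i)) (cong (proj₁ e) (fold-suc next i t))

wordSetoid : ℕ → ℕ → DecSetoid 0ℓ 0ℓ
wordSetoid n k = record
  { Carrier = Word n k
  ; _≈_     = λ e f → proj₁ e ∼ proj₁ f
  ; isDecEquivalence = record
    { isEquivalence = record { refl = ≗⇒∼ λ _ → refl ; sym = ∼-sym ; trans = ∼-trans }
    ; _≟_ = λ e f → ∼? (proj₁ e) (proj₁ f)
    }
  }

vecs : ∀ n k → List (Vec (Fin k) n)
vecs zero    k = [] ∷ []
vecs (suc n) k = List.cartesianProductWith _∷_ (List.allFin k) (vecs n k)

∈-vecs : ∀ {n k} (xs : Vec (Fin k) n) → xs Membership≡.∈ vecs n k
∈-vecs []       = here refl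
∈-vecs (x ∷ xs) = Membership≡ₚ.∈-cartesianProductWith⁺ _∷_ (Membership≡ₚ.∈-allFin x) (∈-vecs xs)

ontos : ∀ {n k} → List (Vec (Fin k) n) → List (Word n k)
ontos []         = []
ontos (xs ∷ xss) with onto? (lookup xs)
... | yes p = (lookup xs , p) ∷ ontos xss
... | no _  = ontos xss

∈-ontos : ∀ {n k} {xs : Vec (Fin k) n} {xss} → Onto (lookup xs) → xs Membership≡.∈ xss →
          Any.Any (λ e → lookup xs ∼ proj₁ e) (ontos xss)
∈-ontos {xs = xs} onto (here refl) with onto? (lookup xs)
... | yes _ = here (≗⇒∼ λ _ → refl)
... | no ¬p = contradiction onto ¬p
∈-ontos {xss = ys ∷ _} onto (there xs∈) with onto? (lookup ys)
... | yes _ = there (∈-ontos onto xs∈)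
... | no _  = ∈-ontos onto xs∈

words : ∀ n k → List (Word n k)
words n k = ontos (vecs n k)

-- A function agrees with its table only pointwise; `_∼_` absorbs the difference, so listing tables
-- suffices.
∈-words : ∀ {n k} (e : Word n k) → Any.Any (λ f → proj₁ e ∼ proj₁ f) (words n k)
∈-words (f , onto) =
  Any.map (∼-trans f∼) (∈-ontos (Onto-resp-∼ f∼ onto) (∈-vecs (tabulate f)))
  where
  f∼ : f ∼ lookup (tabulate f)
  f∼ = ≗⇒∼ (sym ∘ lookup∘tabulate f)

-- Connecting words by renamings and single changes.

AgreeOff : ∀ {n} {A : Set} → Fin n → Rel (Fin n → A) 0ℓ
AgreeOff i f g = ∀ j → j ≢ i → f j ≡ g j

data _↝_ {n k} (e f : Word n k) : Set where
  relabel : proj₁ e ∼ proj₁ f → e ↝ f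
  change  : ∀ i → AgreeOff i (proj₁ e) (proj₁ f) → e ↝ f

cons : ∀ {n k} → Fin k → Word n k → Word (suc n) k
cons x (f , onto) = x F.∷ f , λ b → let i , p = onto b in suc i , p

change-head : ∀ {n k} {e f : Word (suc n) k} →
              (∀ i → proj₁ e (suc i) ≡ proj₁ f (suc i)) → e ↝ f
change-head p = change zero λ { zero 0≢0 → contradiction refl 0≢0 ; (suc i) _ → p i }

cons-↝ : ∀ {n k} {e f : Word n k} x → e ↝ f → ∃[ y ] cons x e ↝ cons y f
cons-↝ {e = f , onto} {g , _} x (relabel f∼g) with onto x
-- The prefixed symbol is renamed along with the others: `f` is onto, so `x` occurs at some `l` and
-- becomes `g l`.
... | l , refl = g l , relabel (mk∼ λ
  { zero    zero    → mk⇔ (λ _ → refl) (λ _ → refl)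
  ; zero    (suc j) → kernel f∼g l j
  ; (suc i) zero    → kernel f∼g i l
  ; (suc i) (suc j) → kernel f∼g i j })
cons-↝ x (change i p) = x , change (suc i) λ
  { zero    _   → refl
  ; (suc j) j≢i → p j (j≢i ∘ cong suc) }

cons-↝* : ∀ {n k} {e f : Word n k} x → Star _↝_ e f → ∃[ y ] Star _↝_ (cons x e) (cons y f)
cons-↝* x ε        = x , ε
cons-↝* x (s ◅ ss) with cons-↝ x s
... | y , s′ with cons-↝* y ss
... | z , ss′ = z , s′ ◅ ss′

-- If the tail of e misses the first symbol, then it repeats some other symbol, and one of
-- the repeated occurrences can be overwritten by the first symbol.
shorten : ∀ {n k} → k ≤ n → (e : Word (suc n) k) →
          ∃₂ λ x (t : Word n k) → e ↝ cons x t × cons x t ↝ e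
shorten {n} {k} k≤n (f , onto) with any? (λ i → f (suc i) ≟ f zero)
... | yes (i , p) = f zero , (f ∘ suc , tail-onto) ,
  change-head (λ _ → refl) , change-head (λ _ → refl)
  where
  tail-onto : Onto (f ∘ suc)
  tail-onto b with onto b
  ... | zero  , q = i , trans p q
  ... | suc j , q = j , q
shorten {k = zero}  _   (f , _)    | no _ = contradiction (f zero) λ ()
shorten {n} {suc k} k<n (f , onto) | no miss
  with pigeonhole k<n (λ i → punchOut {i = f zero} {f (suc i)} λ p → miss (i , sym p))
... | i , j , i<j , p = f zero , (g , g-onto) ,
  change (suc i) agree , change (suc i) λ l l≢i → sym (agree l l≢i)
  where
  g : Fin n → Fin (suc k)
  g = F.updateAt (f ∘ suc) i (const (f zero))
  agree : AgreeOff (suc i) f (f zero F.∷ g)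
  agree zero    _   = refl
  agree (suc l) l≢i = sym (updateAt-minimal l i (f ∘ suc) (l≢i ∘ cong suc))
  fᵢ≡fⱼ : f (suc i) ≡ f (suc j)
  fᵢ≡fⱼ = punchOut-injective {i = f zero} _ _ p
  g-onto : Onto g
  g-onto b with onto b
  ... | zero  , q = i , trans (updateAt-updates i (f ∘ suc)) q
  ... | suc l , q with l ≟ i
  ... | yes refl = j , trans (updateAt-minimal j i (f ∘ suc) (<⇒≢ i<j ∘ sym)) (trans (sym fᵢ≡fⱼ) q)
  ... | no l≢i   = l , trans (updateAt-minimal l i (f ∘ suc) l≢i) q

-- Induction on the length. Words of length `k` are bijections, so they are renamings of one
-- another. A longer word is first given a tail that is onto; the tails are then joined by
-- induction. Renamings may have altered the first symbol on the way, and one more change resets it.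
words-connected : ∀ {n k} → k ≤′ n → (e f : Word n k) → Star _↝_ e f
words-connected ≤′-refl (f , onto) (g , onto′) =
  relabel (injective⇒∼ (onto⇒injective onto) (onto⇒injective onto′)) ◅ ε
words-connected (≤′-step k≤n) e f
  with shorten (ℕₚ.≤′⇒≤ k≤n) e | shorten (ℕₚ.≤′⇒≤ k≤n) f
... | x , s , e↝ , _ | y , t , _ , ↝f with cons-↝* x (words-connected k≤n s t)
... | z , ss = e↝ ◅ ss ◅◅ change-head (λ _ → refl) ◅ ↝f ◅ ε

word : ∀ {n k} → suc k ≤′ n → Word n (suc k)
word ≤′-refl       = id , λ b → b , refl
word (≤′-step k≤n) = cons zero (word k≤n)

-- Recovering a word from its two truncations.

-- If the first and last symbols of f agree, then f without its last symbol is still onto.  Hence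
-- so is g without its last symbol, and that symbol recurs earlier in g.
ends-meet : ∀ {l k} {f g : Fin (2+ l) → Fin k} → Onto f →
            f ∘ inject₁ ∼ g ∘ inject₁ → f ∘ suc ∼ g ∘ suc →
            f zero ≡ f (fromℕ (suc l)) → g zero ≡ g (fromℕ (suc l))
ends-meet {l} {f = f} {g} onto inits tails p
  with Onto-resp-∼ inits init-onto (g (fromℕ (suc l)))
  where
  init-onto : Onto (f ∘ inject₁)
  init-onto b with onto b
  ... | i , q with view i
  ... | ‵fromℕ     = zero , trans p q
  ... | ‵inject₁ j = j , q
... | zero  , q = q
... | suc j , q =
  trans (to inits {zero} {suc j} (trans p (sym (from tails q)))) q

-- Any two positions other than the first and the last fall together into one of the truncations;
-- the remaining pair is settled by `ends-meet` in both directions. Hence there are no parallel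
-- arcs.
overlay-∼ : ∀ {l k} {f g : Fin (2+ l) → Fin k} → Onto f → Onto g →
            f ∘ inject₁ ∼ g ∘ inject₁ → f ∘ suc ∼ g ∘ suc → f ∼ g
overlay-∼ {l} {f = f} {g} f-onto g-onto inits tails = mk∼ same
  where
  first : ∀ j → f zero ≡ f (suc j) ⇔ g zero ≡ g (suc j)
  first j with view j
  ... | ‵fromℕ     = mk⇔ (ends-meet {f = f} {g} f-onto inits tails)
                        (ends-meet {f = g} {f} g-onto (∼-sym inits) (∼-sym tails))
  ... | ‵inject₁ i = kernel inits zero (suc i)
  same : ∀ i j → f i ≡ f j ⇔ g i ≡ g j
  same zero    zero    = mk⇔ (λ _ → refl) (λ _ → refl)
  same zero    (suc j) = first j
  same (suc i) zero    = mk⇔ (sym ∘ Equivalence.to (first i) ∘ sym)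
                             (sym ∘ Equivalence.from (first i) ∘ sym)
  same (suc i) (suc j) = kernel tails i j

lookup-init : ∀ {n} {A : Set} (xs : Vec A (suc n)) i → lookup (init xs) i ≡ lookup xs (inject₁ i)
lookup-init {suc n} (x ∷ xs) zero    = refl
lookup-init {suc n} (x ∷ xs) (suc i) = lookup-init xs i

init-tabulate : ∀ {n} {A : Set} (f : Fin (suc n) → A) → init (tabulate f) ≡ tabulate (f ∘ inject₁)
init-tabulate {zero}  f = refl
init-tabulate {suc n} f = cong (f zero ∷_) (init-tabulate (f ∘ suc))

-- The rotation on the transition digraph.

module TransitionRotation (l k : ℕ) where

  K : ℕ
  K = suc k

  open Setoid (vertexSetoid (2+ l) K) using (_≈_; Carrier)

  -- For the function `lookup r` this unfolds to `RepresentsVertex`; general functions spare the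
  -- passage through vectors.
  LabelsVertex : ∀ {A : Set} → (Fin (suc l) → A) → Carrier → Set
  LabelsVertex f = [ Labels f , Labels f ]

  LabelsVertex-resp-∼ : ∀ {A B : Set} {f : Fin (suc l) → A} {g : Fin (suc l) → B} →
                        f ∼ g → ∀ v → LabelsVertex f v → LabelsVertex g v
  LabelsVertex-resp-∼ f∼g (inj₁ p) ℓ = Labels-resp-∼ f∼g {p} ℓ
  LabelsVertex-resp-∼ f∼g (inj₂ p) ℓ = Labels-resp-∼ f∼g {p} ℓ

  ∼⇒≈ : ∀ {A B : Set} {f : Fin (suc l) → A} {g : Fin (suc l) → B} v w →
        LabelsVertex f v → LabelsVertex g w → f ∼ g → v ≈ w
  ∼⇒≈ (inj₁ p) (inj₁ q) ℓ ℓ′ f∼g = inj₁ (∼⇒⊑ p q e , ∼⇒⊑ q p (∼-sym e))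
    where e = index-∼ p q ℓ ℓ′ f∼g
  ∼⇒≈ (inj₂ p) (inj₂ q) ℓ ℓ′ f∼g = inj₂ (∼⇒⊑ p q e , ∼⇒⊑ q p (∼-sym e))
    where e = index-∼ p q ℓ ℓ′ f∼g
  -- Equal kernels would force `K` and `k` parts to be equally many.
  ∼⇒≈ (inj₁ p) (inj₂ q) ℓ ℓ′ f∼g =
    contradiction (∼⇒parts≤ p q (index-∼ p q ℓ ℓ′ f∼g)) ℕₚ.1+n≰n
  ∼⇒≈ (inj₂ p) (inj₁ q) ℓ ℓ′ f∼g =
    contradiction (∼⇒parts≤ q p (∼-sym (index-∼ p q ℓ ℓ′ f∼g))) ℕₚ.1+n≰n

  ≈⇒∼ : ∀ {A B : Set} {f : Fin (suc l) → A} {g : Fin (suc l) → B} v w →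
        LabelsVertex f v → LabelsVertex g w → v ≈ w → f ∼ g
  ≈⇒∼ (inj₁ p) (inj₁ q) ℓ ℓ′ (inj₁ (p⊑q , q⊑p)) = Labels-∼ q (λ i j → mk⇔
    (SamePart-resp {p = p} {q} p⊑q ∘ Equivalence.to (ℓ i j))
    (Equivalence.from (ℓ i j) ∘ SamePart-resp {p = q} {p} q⊑p)) ℓ′
  ≈⇒∼ (inj₂ p) (inj₂ q) ℓ ℓ′ (inj₂ (p⊑q , q⊑p)) = Labels-∼ q (λ i j → mk⇔
    (SamePart-resp {p = p} {q} p⊑q ∘ Equivalence.to (ℓ i j))
    (Equivalence.from (ℓ i j) ∘ SamePart-resp {p = q} {p} q⊑p)) ℓ′

  -- Only `a` can be missing. If it occurs, the fibres of `f` are `K` parts; if not, punching it out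
  -- keeps the kernel and leaves a surjection onto `k` symbols.
  vertexOf : (f : Fin (suc l) → Fin K) (a : Fin K) → (∀ b → b ≢ a → ∃[ i ] f i ≡ b) →
             ∃[ v ] LabelsVertex f v
  vertexOf f a onto with any? (λ i → f i ≟ a)
  ... | yes (i , p) = inj₁ (fibres f f-onto) , fibres-labels f f-onto
    where
    f-onto : Onto f
    f-onto b with b ≟ a
    ... | yes refl = i , p
    ... | no b≢a   = onto b b≢a
  ... | no miss = inj₂ (fibres g g-onto) ,
    Labels-resp-∼ g∼f {fibres g g-onto} (fibres-labels g g-onto)
    where
    a≢f : ∀ i → a ≢ f i
    a≢f i p = miss (i , sym p)
    g : Fin (suc l) → Fin k
    g i = punchOut (a≢f i)
    g-onto : Onto g
    g-onto b with onto (punchIn a b) (punchInᵢ≢i a b)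
    ... | i , p = i , trans (punchOut-cong a p) (punchOut-punchIn a)
    g∼f : g ∼ f
    g∼f = mk∼ λ i j → mk⇔ (punchOut-injective (a≢f i) (a≢f j)) (punchOut-cong a)

  sourceOf : (e : Word (2+ l) K) → ∃[ v ] LabelsVertex (proj₁ e ∘ inject₁) v
  sourceOf (f , onto) = vertexOf (f ∘ inject₁) (f (fromℕ _)) init-onto
    where
    -- Dropping the last position can lose only the symbol standing there.
    init-onto : ∀ b → b ≢ f (fromℕ _) → ∃[ i ] f (inject₁ i) ≡ b
    init-onto b b≢ with onto b
    ... | i , p with view i
    ... | ‵fromℕ     = contradiction (sym p) b≢
    ... | ‵inject₁ j = j , p

  source : Word (2+ l) K → Carrier
  source = proj₁ ∘ sourceOf

  source-labels : ∀ e → LabelsVertex (proj₁ e ∘ inject₁) (source e)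
  source-labels = proj₂ ∘ sourceOf

  -- Rotation moves the first symbol to the end, where taking the source discards it.
  target-labels : ∀ e → LabelsVertex (proj₁ e ∘ suc) (source (rotate e))
  target-labels e = LabelsVertex-resp-∼ (next-inject₁-∼ (proj₁ e)) (source (rotate e))
    (source-labels (rotate e))

  source-cong : ∀ {e f : Word (2+ l) K} → proj₁ e ∘ inject₁ ∼ proj₁ f ∘ inject₁ →
                source e ≈ source f
  source-cong {e} {f} = ∼⇒≈ (source e) (source f) (source-labels e) (source-labels f)

  word-edge : ∀ e → TEdge (2+ l) K (source e) (source (rotate e))
  word-edge e@(f , onto) =
    tabulate (f ∘ inject₁) , tabulate (f ∘ suc) ,
    represents (source e) (source-labels e) ,
    represents (source (rotate e)) (target-labels e) ,
    sym (init-tabulate (f ∘ suc)) ,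
    fibres f onto ,
    Labels-resp-∼ (≗⇒∼ (sym ∘ lookup∘tabulate f)) {fibres f onto} (fibres-labels f onto)
    where
    represents : ∀ {g} v → LabelsVertex g v → RepresentsVertex (2+ l) K (tabulate g) v
    represents {g} (inj₁ p) = Labels-resp-∼ (≗⇒∼ (sym ∘ lookup∘tabulate g)) {p}
    represents {g} (inj₂ p) = Labels-resp-∼ (≗⇒∼ (sym ∘ lookup∘tabulate g)) {p}

  edge-word : ∀ {v w} → TEdge (2+ l) K v w → ∃[ e ] source e ≈ v × source (rotate e) ≈ w
  edge-word {v} {w} (x ∷ xs , s , ρ , ρ′ , eq , p , labels) =
    e , ∼⇒≈ (source e) v (source-labels e) ρ (≗⇒∼ prefix)
      , ∼⇒≈ (source (rotate e)) w (target-labels e) ρ′ (≗⇒∼ λ _ → refl)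
    where
    e : Word (2+ l) K
    -- The overlaid string has the kernel of a partition into `K` parts, so it uses all `K` symbols.
    e = lookup (x ∷ s) , Onto-resp-∼ (Labels-∼ p (index-labels p) labels) (index-onto p)
    prefix : lookup (x ∷ s) ∘ inject₁ ≗ lookup (x ∷ xs)
    prefix zero    = refl
    prefix (suc i) = trans (sym (lookup-init s i)) (cong (λ ys → lookup ys i) (sym eq))

  _—_ : Rel (Word (2+ l) K) 0ℓ
  _—_ = Link (λ e f → source e ≈ source f) rotate

  -- A rotation moves a difference at `suc i` to `inject₁ i`, and a difference at `zero` to the last
  -- position, which the source ignores. After `toℕ i + 1` turns the sources coincide.
  agreeOff⇒— : ∀ i {e f} → AgreeOff i (proj₁ e) (proj₁ f) → e — f
  agreeOff⇒— = <-weakInduction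
    (λ i → ∀ {e f : Word (2+ l) K} → AgreeOff i (proj₁ e) (proj₁ f) → e — f)
    (λ {e} {f} p → turn (fork (source-cong {rotate e} {rotate f} (≗⇒∼ λ i →
      p (next (inject₁ i)) λ q → contradiction (trans (sym (next-inject₁ i)) q) λ ()))))
    (λ i ih {e} {f} p → turn (ih λ j j≢i → p (next j) λ q →
      j≢i (next-injective (trans q (sym (next-inject₁ i))))))

  ↝⇒— : ∀ {e f} → e ↝ f → e — f
  ↝⇒— {e} {f} (relabel e∼f) = fork (source-cong {e} {f} (∼-∘ inject₁ e∼f))
  ↝⇒— (change i p)          = agreeOff⇒— i p

  arcRotation : K ≤ 2+ l → ArcRotation (transitionDigraph (2+ l) K)
  arcRotation K≤n = record
    { arcs       = wordSetoid (2+ l) K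
    ; src        = source
    ; src-cong   = λ {e} {f} → source-cong {e} {f} ∘ ∼-∘ inject₁
    ; σ          = rotate
    ; σ-cong     = ∼-∘ next
    ; period-1   = suc l
    ; periodic   = λ e → ≗⇒∼ λ i →
        trans (fold-rotate e (2+ l) i) (cong (proj₁ e) (next-periodic i))
    ; arc-edge   = word-edge
    ; edge-arc   = edge-word
    ; arc-unique = λ {e} {f} s t → overlay-∼ (proj₂ e) (proj₂ f)
        (≈⇒∼ (source e) (source f) (source-labels e) (source-labels f) s)
        (≈⇒∼ (source (rotate e)) (source (rotate f)) (target-labels e) (target-labels f) t)
    ; all        = words (2+ l) K
    ; all-∈      = ∈-words
    ; base       = word (ℕₚ.≤⇒≤′ K≤n)
    ; connected  = λ f → Star.map ↝⇒— (words-connected (ℕₚ.≤⇒≤′ K≤n) _ f)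
    }

theorem5 : ∀ (n k : ℕ) → 2 ≤ k → k < n → EulerianCycle (transitionDigraph n k)
theorem5 (2+ l) (suc k) _ k<n =
  Eulerian.eulerianCycle (TransitionRotation.arcRotation l k (ℕₚ.<⇒≤ k<n))
theorem5 1 (suc _) _ (s≤s ())
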